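{- Let $n,m$ be positive integers. For $\lambda=(\lambda_1,\dots,\lambda_n)\in\mathcal{P}^m_n$ define integers $k_{i,j}(\lambda)$, $1\le i\le j\le n$, recursively (in order of decreasing $i$, and for fixed $i$ in order of decreasing $j$) by $$k_{i,j}(\lambda)=\min\left\{m,\left\lceil\frac{\lambda_i-\sum_{\ell=j+1}^n k_{i,\ell}(\lambda)+\sum_{\ell=i+1}^j k_{\ell,j}(\lambda)}{j-i+1}\right\rceil\right\}.$$ Then the map $\bar\varphi_n:\mathcal{P}^m_n\to\mathcal{T}^m_n$ sending $\lambda$ to the tableau $\{k_{i,j}(\lambda):1\le i\le j\le n\}$ is injective.
   Context: $\mathcal{P}^m_n$ is the set of integer partitions $(\lambda_1\ge\cdots\ge\lambda_n\ge0)$ with $\lambda_i\le m(n-i+1)$ for all $i$. $\mathcal{T}^m_n$ is the set of fillings of the staircase Young diagram of shape $(n,n-1,\dots,1)$ by integers in $\{0,1,\dots,m\}$, where the entry $k_{i,j}$ occupies the box in row $i$, column $n-j+1$ ($1\le i\le j\le n$). -}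

module Defs where

open import Algebra.Properties.CommutativeMonoid.Sum using (sum-cong-≗)
open import Data.Fin using (Fin; toℕ; fromℕ<; _≤_; _<_; _>_; _≤?_; _<?_)
open import Data.Fin.Induction using (>-wellFounded)
open import Data.Fin.Properties using (toℕ<n)
open import Data.Integer as ℤ using (ℤ; +_; 0ℤ)
open import Data.Integer.Properties using (+-0-commutativeMonoid)
open import Data.Nat as ℕ using (ℕ; suc; s≤s)
open import Data.Nat.Properties using (∸-monoʳ-<)
open import Data.Product using (_×_; proj₁)
open import Data.Rational.Unnormalised using (ceiling; _/_)
open import Induction.WellFounded using (Acc; acc)
open import Relation.Binary.PropositionalEquality using (_≡_; refl)
open import Relation.Nullary using (Dec; yes; no)
open import Relation.Nullary.Decidable using (_×-dec_)
open import Relation.Unary using (Pred; Decidable)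

open import Algebra.Properties.CommutativeMonoid.Sum +-0-commutativeMonoid
  using (sum)

-- Indices i, j, ℓ ∈ {1,…,n} are represented by Fin n, so toℕ i = i − 1.

-- m (n − i + 1) is m * (n ∸ toℕ i) because toℕ i = i − 1.
record Partition (m n : ℕ) : Set where
  field
    part       : Fin n → ℕ
    decreasing : ∀ {i j} → i ≤ j → part j ℕ.≤ part i
    bounded    : ∀ i → part i ℕ.≤ m ℕ.* (n ℕ.∸ toℕ i)

open Partition public

_≈ᴾ_ : ∀ {m n} → Partition m n → Partition m n → Set
λ₁ ≈ᴾ λ₂ = ∀ i → part λ₁ i ≡ part λ₂ i

-- The row with index r of the staircase (n, n−1, …, 1) has n − toℕ r boxes,
-- and Fin (suc m) is {0, 1, …, m}.
Tableau : ℕ → ℕ → Set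
Tableau m n = (r : Fin n) → Fin (n ℕ.∸ toℕ r) → Fin (suc m)

_≈ᵀ_ : ∀ {m n} → Tableau m n → Tableau m n → Set
T₁ ≈ᵀ T₂ = ∀ r c → T₁ r c ≡ T₂ r c

-- Column n − j + 1, which counted from 0 is n − (1 + toℕ j).
column : ∀ {n} {i j : Fin n} → i ≤ j → Fin (n ℕ.∸ toℕ i)
column {j = j} i≤j = fromℕ< (∸-monoʳ-< (s≤s i≤j) (toℕ<n j))

-- The entry of T in position k_{i,j}.
entry : ∀ {m n} → Tableau m n → {i j : Fin n} → i ≤ j → Fin (suc m)
entry T {i} i≤j = T i (column i≤j)

-- ∑[ P? ] f is the sum of f ℓ over all ℓ satisfying P; the summand may use
-- the proof that ℓ is in range, as the recursion below must.
onlyIf : {A : Set} → Dec A → (A → ℤ) → ℤ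
onlyIf (yes a) f = f a
onlyIf (no _)  f = 0ℤ

∑[_] : ∀ {n} {P : Pred (Fin n) _} → Decidable P → (∀ {ℓ} → P ℓ → ℤ) → ℤ
∑[ P? ] f = sum λ ℓ → onlyIf (P? ℓ) f

-- Recursion on decreasing i and j.  Only the values with i ≤ j are meaningful,
-- and these depend only on values with i ≤ j; there suc (toℕ j ∸ toℕ i) is
-- j − i + 1.
kAcc : ∀ {m n} → Partition m n → {i j : Fin n} → Acc _>_ i → Acc _>_ j → ℤ
kAcc {m} p {i} {j} (acc rsᵢ) (acc rsⱼ) =
  + m ℤ.⊓ ceiling
    ((+ part p i
      ℤ.- ∑[ (λ ℓ → j <? ℓ) ] (λ j<ℓ → kAcc p (acc rsᵢ) (rsⱼ j<ℓ))
      ℤ.+ ∑[ (λ ℓ → (i <? ℓ) ×-dec (ℓ ≤? j)) ]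
            (λ r → kAcc p (rsᵢ (proj₁ r)) (acc rsⱼ)))
     / suc (toℕ j ℕ.∸ toℕ i))

k : ∀ {m n} → Partition m n → Fin n → Fin n → ℤ
k p i j = kAcc p (>-wellFounded i) (>-wellFounded j)

private
  ∑-cong : ∀ {n} {P : Pred (Fin n) _} (P? : Decidable P)
           {f g : ∀ {ℓ} → P ℓ → ℤ} →
           (∀ {ℓ} (x : P ℓ) → f x ≡ g x) → ∑[ P? ] f ≡ ∑[ P? ] g
  ∑-cong P? {f} {g} f≗g =
    sum-cong-≗ +-0-commutativeMonoid (λ ℓ → onlyIf-cong (P? ℓ))
    where
    onlyIf-cong : ∀ {ℓ} (d : Dec _) → onlyIf d (f {ℓ}) ≡ onlyIf d g
    onlyIf-cong (yes x) = f≗g x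
    onlyIf-cong (no _)  = refl

  formula-cong : ∀ m a d {s s′ t t′} → s ≡ s′ → t ≡ t′ →
                 + m ℤ.⊓ ceiling ((a ℤ.- s ℤ.+ t) / suc d) ≡
                 + m ℤ.⊓ ceiling ((a ℤ.- s′ ℤ.+ t′) / suc d)
  formula-cong m a d refl refl = refl

  kAcc-irrelevant : ∀ {m n} (p : Partition m n) {i j : Fin n}
                    (x x′ : Acc _>_ i) (y y′ : Acc _>_ j) →
                    kAcc p x y ≡ kAcc p x′ y′
  kAcc-irrelevant {m} p {i} {j} (acc x) (acc x′) (acc y) (acc y′) =
    formula-cong m (+ part p i) (toℕ j ℕ.∸ toℕ i)
      (∑-cong (λ ℓ → j <? ℓ)
        (λ j<ℓ → kAcc-irrelevant p (acc x) (acc x′) (y j<ℓ) (y′ j<ℓ)))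
      (∑-cong (λ ℓ → (i <? ℓ) ×-dec (ℓ ≤? j))
        (λ r → kAcc-irrelevant p (x (proj₁ r)) (x′ (proj₁ r)) (acc y) (acc y′)))

  kAcc-unfold : ∀ {m n} (p : Partition m n) {i j : Fin n}
                (x : Acc _>_ i) (y : Acc _>_ j) →
    kAcc p x y ≡
      + m ℤ.⊓ ceiling
        ((+ part p i
          ℤ.- ∑[ (λ ℓ → j <? ℓ) ] (λ {ℓ} _ → k p i ℓ)
          ℤ.+ ∑[ (λ ℓ → (i <? ℓ) ×-dec (ℓ ≤? j)) ] (λ {ℓ} _ → k p ℓ j))
         / suc (toℕ j ℕ.∸ toℕ i))
  kAcc-unfold {m} p {i} {j} (acc x) (acc y) =
    formula-cong m (+ part p i) (toℕ j ℕ.∸ toℕ i)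
      (∑-cong (λ ℓ → j <? ℓ)
        (λ {ℓ} j<ℓ → kAcc-irrelevant p
          (acc x) (>-wellFounded i) (y j<ℓ) (>-wellFounded ℓ)))
      (∑-cong (λ ℓ → (i <? ℓ) ×-dec (ℓ ≤? j))
        (λ {ℓ} r → kAcc-irrelevant p
          (x (proj₁ r)) (>-wellFounded ℓ) (acc y) (>-wellFounded j)))

k-recursion : ∀ {m n} (p : Partition m n) (i j : Fin n) →
  k p i j ≡
    + m ℤ.⊓ ceiling
      ((+ part p i
        ℤ.- ∑[ (λ ℓ → j <? ℓ) ] (λ {ℓ} _ → k p i ℓ)
        ℤ.+ ∑[ (λ ℓ → (i <? ℓ) ×-dec (ℓ ≤? j)) ] (λ {ℓ} _ → k p ℓ j))
       / suc (toℕ j ℕ.∸ toℕ i))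
k-recursion p i j = kAcc-unfold p (>-wellFounded i) (>-wellFounded j)

{-# OPTIONS --safe #-}
module Submission where

-- Let R_i(t) = λ_i − Σ_{ℓ ≥ t} k_{i,ℓ}; with 1-based t = j + 1 it is the
-- remainder entering the definition of k_{i,j}.  If consecutive rows had
-- λ_i = λ_{i+1}, their entries in common columns would agree; in general, since
-- r ↦ r − min{m, ⌈(r + c)/d⌉} is nondecreasing on integers, λ_i ≥ λ_{i+1} gives
-- R_i(t) ≥ R_{i+1}(t) for t > i.  Hence all R_i(t) with t ≥ i, and so all
-- entries, are nonnegative, by induction on rows from the bottom.  Conversely
-- λ_i ≤ m(n − i + 1) propagates to R_i(t) ≤ m(t − i).  At t = i both bounds
-- force R_i(i) = 0, so that λ_i is the sum of the i-th row.

open import Defs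
open import Data.Fin using (Fin; toℕ; _≤_)
open import Data.Integer using (+_)
open import Data.Nat using (ℕ; NonZero)
open import Data.Product using (Σ-syntax; _×_)
open import Function.Definitions using (Injective)
open import Relation.Binary.PropositionalEquality using (_≡_)

open import Data.Fin using (fromℕ<; punchIn; _>_; _<?_; _≤?_)
open import Data.Fin.Induction using (>-wellFounded)
open import Data.Fin.Properties using (toℕ<n; toℕ-fromℕ<; toℕ-injective; punchInᵢ≢i)
open import Data.Integer as ℤ using (ℤ; 0ℤ; 1ℤ; -1ℤ; ∣_∣)
open import Data.Integer.DivMod using ([n/d]*d≤n; n<s[n/ℕd]*d; div-pos-is-/ℕ)
import Data.Integer.Properties as ℤ
open import Data.Integer.Tactic.RingSolver using (solve-∀)
open import Data.Nat as ℕ using (zero; suc; z≤n; s≤s)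
import Data.Nat.Properties as ℕ
open import Data.Product using (_,_; proj₁; proj₂)
open import Data.Rational.Unnormalised using (ceiling; _/_)
open import Data.Sum using (_⊎_; inj₁; inj₂; [_,_]′)
open import Function using (_∘_; id)
open import Induction.WellFounded using (Acc; acc)
open import Level using (0ℓ)
open import Relation.Binary.PropositionalEquality
  using (refl; sym; trans; cong; cong₂; subst; subst₂; module ≡-Reasoning)
open import Relation.Nullary using (¬_; Dec; yes; no; contradiction)
open import Relation.Nullary.Decidable using (_×-dec_)
open import Relation.Unary using (Pred; Decidable)

open import Algebra.Properties.CommutativeMonoid.Sum ℤ.+-0-commutativeMonoid
  using (sum; sum-cong-≗; sum-remove; sum-replicate-zero)

-- Integer inequalities and capped ceilings.

≤-of-difference : ∀ {x y} e → 0ℤ ℤ.≤ e → y ℤ.- x ≡ e → x ℤ.≤ y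
≤-of-difference e 0≤e eq = ℤ.0≤i-j⇒j≤i (subst (0ℤ ℤ.≤_) (sym eq) 0≤e)

+-nonNeg : ∀ {x y} → 0ℤ ℤ.≤ x → 0ℤ ℤ.≤ y → 0ℤ ℤ.≤ x ℤ.+ y
+-nonNeg = ℤ.+-mono-≤

-- Characterises κ = min{m, ⌈a / (d + 1)⌉}.
record IsCappedCeiling (m : ℕ) (a : ℤ) (d : ℕ) (κ : ℤ) : Set where
  field
    ≤cap     : κ ℤ.≤ + m
    pred<    : + suc d ℤ.* ℤ.pred κ ℤ.< a
    capped⊎≤ : κ ≡ + m ⊎ a ℤ.≤ + suc d ℤ.* κ

open IsCappedCeiling

-- `ceiling` is the negated floor of the negated fraction, so negating the division bounds for `- a`
-- gives the bounds here and in `*pred-ceiling<`.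
≤*ceiling : ∀ a d → a ℤ.≤ + suc d ℤ.* ceiling (a / suc d)
≤*ceiling a d = subst₂ ℤ._≤_ (ℤ.neg-involutive a) (identity q D)
  (ℤ.neg-mono-≤ ([n/d]*d≤n (ℤ.- a) D))
  where
  D = + suc d
  q = (ℤ.- a) ℤ./ D
  identity : ∀ q D → ℤ.- (q ℤ.* D) ≡ D ℤ.* (ℤ.- q)
  identity = solve-∀

*pred-ceiling< : ∀ a d → + suc d ℤ.* ℤ.pred (ceiling (a / suc d)) ℤ.< a
*pred-ceiling< a d = subst₂ ℤ._<_ (identity q D) (ℤ.neg-involutive a)
  (ℤ.neg-mono-< (subst (λ x → ℤ.- a ℤ.< ℤ.suc x ℤ.* D)
    (sym (div-pos-is-/ℕ (ℤ.- a) (suc d))) (n<s[n/ℕd]*d (ℤ.- a) (suc d))))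
  where
  D = + suc d
  q = (ℤ.- a) ℤ./ D
  identity : ∀ q D → ℤ.- ((1ℤ ℤ.+ q) ℤ.* D) ≡ D ℤ.* (-1ℤ ℤ.+ (ℤ.- q))
  identity = solve-∀

isCappedCeiling : ∀ m a d → IsCappedCeiling m a d (+ m ℤ.⊓ ceiling (a / suc d))
isCappedCeiling m a d = record
  { ≤cap = ℤ.i⊓j≤i (+ m) c
  ; pred< = ℤ.≤-<-trans
      (ℤ.*-monoˡ-≤-nonNeg (+ suc d) (ℤ.pred-mono (ℤ.i⊓j≤j (+ m) c)))
      (*pred-ceiling< a d)
  ; capped⊎≤ = [ inj₁ , (λ eq → inj₂ (subst (λ x → a ℤ.≤ + suc d ℤ.* x) (sym eq) (≤*ceiling a d))) ]′
      (ℤ.⊓-sel (+ m) c)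
  }
  where c = ceiling (a / suc d)

module _ {m : ℕ} {a : ℤ} {d : ℕ} {κ : ℤ} (h : IsCappedCeiling m a d κ) where

  capped-nonNeg : 0ℤ ℤ.≤ a → 0ℤ ℤ.≤ κ
  capped-nonNeg 0≤a with capped⊎≤ h
  ... | inj₁ refl = ℤ.+≤+ z≤n
  ... | inj₂ a≤Dκ = ℤ.*-cancelˡ-≤-pos 0ℤ κ (+ suc d)
    (subst (ℤ._≤ + suc d ℤ.* κ) (sym (ℤ.*-zeroʳ (+ suc d))) (ℤ.≤-trans 0≤a a≤Dκ))

  -- If `κ = m`, both sides drop by `m`. Otherwise `r + c ≤ (d + 1)κ`, so `r - κ ≤ dκ - c ≤ dm`.
  remainder-≤-step : ∀ {r c} → a ≡ r ℤ.+ c → 0ℤ ℤ.≤ c → r ℤ.≤ + m ℤ.* + suc d →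
                     r ℤ.- κ ℤ.≤ + m ℤ.* + d
  remainder-≤-step {r} {c} refl 0≤c r≤mD with capped⊎≤ h
  ... | inj₁ refl = ≤-of-difference _ (ℤ.i≤j⇒0≤j-i r≤mD) (identity (+ m) r (+ d))
    where
    identity : ∀ m r d → m ℤ.* d ℤ.- (r ℤ.- m) ≡ m ℤ.* (1ℤ ℤ.+ d) ℤ.- r
    identity = solve-∀
  ... | inj₂ a≤Dκ = ≤-of-difference _
    (+-nonNeg (+-nonNeg (ℤ.i≤j⇒0≤j-i a≤Dκ) 0≤c)
      (ℤ.i≤j⇒0≤j-i (ℤ.*-monoˡ-≤-nonNeg (+ d) (≤cap h))))
    (identity (+ m) r (+ d) κ c)
    where
    identity : ∀ m r d κ c → m ℤ.* d ℤ.- (r ℤ.- κ) ≡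
      ((1ℤ ℤ.+ d) ℤ.* κ ℤ.- (r ℤ.+ c)) ℤ.+ c ℤ.+ (d ℤ.* m ℤ.- d ℤ.* κ)
    identity = solve-∀

-- With divisor 1 the ceiling is `a` itself, and the cap can only lower it.
capped-≤ : ∀ {m a κ} → IsCappedCeiling m a 0 κ → κ ℤ.≤ a
capped-≤ {a = a} {κ} h = subst (ℤ._≤ a) (ℤ.suc-pred κ) (ℤ.i<j⇒suc[i]≤j
  (subst (ℤ._< a) (ℤ.*-identityˡ (ℤ.pred κ)) (pred< h)))

-- Primed data belong to the row below: its entry `κ′` joins the column sum of the upper row, whose
-- divisor is one larger. If `κ′ = m`, the cap gives `κ ≤ κ′`; otherwise `κ ≤ κ′ + (r - r′)` is
-- shown.
remainder-mono-step : ∀ {m d r r′ c κ κ′} →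
  IsCappedCeiling m (r′ ℤ.+ c) d κ′ →
  IsCappedCeiling m (r ℤ.+ (κ′ ℤ.+ c)) (suc d) κ →
  r′ ℤ.≤ r → r′ ℤ.- κ′ ℤ.≤ r ℤ.- κ
remainder-mono-step {m} {d} {r} {r′} {c} {κ} {κ′} h′ h r′≤r with capped⊎≤ h′
... | inj₁ refl = ℤ.+-mono-≤ r′≤r (ℤ.neg-mono-≤ (≤cap h))
... | inj₂ a′≤Dκ′ = ≤-of-difference _ (ℤ.i≤j⇒0≤j-i κ≤) (identity₂ r r′ κ κ′)
  where
  δ = r ℤ.- r′
  identity₁ : ∀ r r′ c d κ′ →
    (1ℤ ℤ.+ (1ℤ ℤ.+ d)) ℤ.* (κ′ ℤ.+ (r ℤ.- r′)) ℤ.- (r ℤ.+ (κ′ ℤ.+ c)) ≡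
    ((1ℤ ℤ.+ d) ℤ.* κ′ ℤ.- (r′ ℤ.+ c)) ℤ.+ (1ℤ ℤ.+ d) ℤ.* (r ℤ.- r′)
  identity₁ = solve-∀
  identity₂ : ∀ r r′ κ κ′ →
    (r ℤ.- κ) ℤ.- (r′ ℤ.- κ′) ≡ (κ′ ℤ.+ (r ℤ.- r′)) ℤ.- κ
  identity₂ = solve-∀
  0≤Dδ : 0ℤ ℤ.≤ + suc d ℤ.* δ
  0≤Dδ = subst (ℤ._≤ + suc d ℤ.* δ) (ℤ.*-zeroʳ (+ suc d))
    (ℤ.*-monoˡ-≤-nonNeg (+ suc d) (ℤ.i≤j⇒0≤j-i r′≤r))
  -- From `r′ + c ≤ (d + 1)κ′` and `δ ≥ 0`, the upper numerator `r + κ′ + c` is at most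
  -- `(d + 2)(κ′ + δ)`.
  pred<bound : ℤ.pred κ ℤ.< κ′ ℤ.+ δ
  pred<bound = ℤ.*-cancelˡ-<-nonNeg (+ suc (suc d)) (ℤ.<-≤-trans (pred< h)
    (≤-of-difference _ (+-nonNeg (ℤ.i≤j⇒0≤j-i a′≤Dκ′) 0≤Dδ)
      (identity₁ r r′ c (+ d) κ′)))
  κ≤ : κ ℤ.≤ κ′ ℤ.+ δ
  κ≤ = subst (ℤ._≤ κ′ ℤ.+ δ) (ℤ.suc-pred κ) (ℤ.i<j⇒suc[i]≤j pred<bound)

-- Sums over decidable ranges.

sumOver : ∀ {n} {P : Pred (Fin n) 0ℓ} → Decidable P → (Fin n → ℤ) → ℤ
sumOver P? f = ∑[ P? ] (λ {ℓ} _ → f ℓ)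

onlyIf-cong : {A B : Set} (A? : Dec A) (B? : Dec B) → (A → B) → (B → A) →
              {x y : ℤ} → (A → x ≡ y) → onlyIf A? (λ _ → x) ≡ onlyIf B? (λ _ → y)
onlyIf-cong (yes a) (yes b) f g x≡y = x≡y a
onlyIf-cong (yes a) (no ¬b) f g _ = contradiction (f a) ¬b
onlyIf-cong (no ¬a) (yes b) f g _ = contradiction (g b) ¬a
onlyIf-cong (no ¬a) (no ¬b) f g _ = refl

onlyIf-yes : {A : Set} (A? : Dec A) (x : ℤ) → A → onlyIf A? (λ _ → x) ≡ x
onlyIf-yes (yes _) x _ = refl
onlyIf-yes (no ¬a) x a = contradiction a ¬a

onlyIf-no : {A : Set} (A? : Dec A) (x : ℤ) → ¬ A → onlyIf A? (λ _ → x) ≡ 0ℤ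
onlyIf-no (yes a) x ¬a = contradiction a ¬a
onlyIf-no (no _)  x _ = refl

sumOver-cong : ∀ {n} {P : Pred (Fin n) 0ℓ} (P? : Decidable P) {f g} →
  (∀ {ℓ} → P ℓ → f ℓ ≡ g ℓ) → sumOver P? f ≡ sumOver P? g
sumOver-cong P? f≗g = sum-cong-≗
  (λ ℓ → onlyIf-cong (P? ℓ) (P? ℓ) id id f≗g)

sumOver-empty : ∀ {n} {P : Pred (Fin n) 0ℓ} (P? : Decidable P) f →
  (∀ ℓ → ¬ P ℓ) → sumOver P? f ≡ 0ℤ
sumOver-empty {n} P? f ¬P = trans
  (sum-cong-≗ (λ ℓ → onlyIf-no (P? ℓ) (f ℓ) (¬P ℓ)))
  (sum-replicate-zero n)

sum-nonNeg : ∀ {n} (f : Fin n → ℤ) → (∀ ℓ → 0ℤ ℤ.≤ f ℓ) → 0ℤ ℤ.≤ sum f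
sum-nonNeg {zero}  f 0≤f = ℤ.≤-refl
sum-nonNeg {suc n} f 0≤f = +-nonNeg (0≤f Fin.zero) (sum-nonNeg (f ∘ Fin.suc) (0≤f ∘ Fin.suc))

sumOver-nonNeg : ∀ {n} {P : Pred (Fin n) 0ℓ} (P? : Decidable P) {f} →
  (∀ {ℓ} → P ℓ → 0ℤ ℤ.≤ f ℓ) → 0ℤ ℤ.≤ sumOver P? f
sumOver-nonNeg P? {f} 0≤f = sum-nonNeg _ (λ ℓ → go (P? ℓ))
  where
  go : ∀ {ℓ} (d : Dec _) → 0ℤ ℤ.≤ onlyIf d (λ _ → f ℓ)
  go (yes a) = 0≤f a
  go (no _)  = ℤ.≤-refl

sumOver-insert : ∀ {n} {P Q : Pred (Fin n) 0ℓ} (P? : Decidable P) (Q? : Decidable Q) (f : Fin n → ℤ) a →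
  Q a → ¬ P a → (∀ {ℓ} → P ℓ → Q ℓ) → (∀ {ℓ} → Q ℓ → ℓ ≡ a ⊎ P ℓ) →
  sumOver Q? f ≡ f a ℤ.+ sumOver P? f
sumOver-insert {suc n} P? Q? f a Qa ¬Pa P⇒Q Q⇒P = begin
  sum F                                   ≡⟨ sum-remove F ⟩
  F a ℤ.+ sum (F ∘ punchIn a)             ≡⟨ cong₂ ℤ._+_ (onlyIf-yes (Q? a) (f a) Qa)
                                               (sum-cong-≗ elsewhere) ⟩
  -- The inserted zero becomes the term of `G` at `a`, so that `sum-remove` can be applied
  -- backwards.
  f a ℤ.+ sum (G ∘ punchIn a)             ≡⟨ cong (ℤ._+_ (f a)) (sym (ℤ.+-identityˡ _)) ⟩
  f a ℤ.+ (0ℤ ℤ.+ sum (G ∘ punchIn a))    ≡⟨ cong (λ x → f a ℤ.+ (x ℤ.+ sum (G ∘ punchIn a)))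
                                               (sym (onlyIf-no (P? a) (f a) ¬Pa)) ⟩
  f a ℤ.+ (G a ℤ.+ sum (G ∘ punchIn a))   ≡⟨ cong (ℤ._+_ (f a)) (sym (sum-remove G)) ⟩
  f a ℤ.+ sum G                           ∎
  where
  open ≡-Reasoning
  F G : Fin (suc n) → ℤ
  F ℓ = onlyIf (Q? ℓ) (λ _ → f ℓ)
  G ℓ = onlyIf (P? ℓ) (λ _ → f ℓ)
  elsewhere : ∀ x → F (punchIn a x) ≡ G (punchIn a x)
  elsewhere x = onlyIf-cong (Q? _) (P? _)
    ([ (λ eq → contradiction eq (punchInᵢ≢i a x)) , id ]′ ∘ Q⇒P) P⇒Q (λ _ → refl)

-- Thresholds run over 0, ..., n but columns over `Fin n`: the induction starts at `n` and each step
-- down passes one column. `≤‴` recurses by raising its left argument.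
downward : ∀ {n} (P : ℕ → Set) → P n → (∀ (j : Fin n) → P (suc (toℕ j)) → P (toℕ j)) →
           ∀ {t} → t ℕ.≤ n → P t
downward {n} P base step t≤n = go (ℕ.≤⇒≤‴ t≤n)
  where
  go : ∀ {t} → t ℕ.≤‴ n → P t
  go ℕ.≤‴-refl = base
  go (ℕ.≤‴-step t<n) = subst P (toℕ-fromℕ< (ℕ.≤‴⇒≤ t<n))
    (step (fromℕ< (ℕ.≤‴⇒≤ t<n)) (subst (P ∘ suc) (sym (toℕ-fromℕ< (ℕ.≤‴⇒≤ t<n))) (go t<n)))

-- Remainders and entries of a fixed partition.

module _ {m n : ℕ} (p : Partition m n) where

  -- `R_i` with thresholds counted from 0. Since `j <? ℓ` unfolds to `suc (toℕ j) ℕ.≤? toℕ ℓ`, the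
  -- value at `suc (toℕ j)` matches the numerator in `k-recursion` definitionally.
  remainder : Fin n → ℕ → ℤ
  remainder i t = + part p i ℤ.- sumOver (λ ℓ → t ℕ.≤? toℕ ℓ) (k p i)

  below : Fin n → Fin n → ℤ
  below i j = sumOver (λ ℓ → (i <? ℓ) ×-dec (ℓ ≤? j)) (λ ℓ → k p ℓ j)

  k-isCapped : ∀ i j → IsCappedCeiling m (remainder i (suc (toℕ j)) ℤ.+ below i j)
                         (toℕ j ℕ.∸ toℕ i) (k p i j)
  k-isCapped i j = subst (IsCappedCeiling m _ _) (sym (k-recursion p i j))
    (isCappedCeiling m _ (toℕ j ℕ.∸ toℕ i))

  remainder-last : ∀ i → remainder i n ≡ + part p i
  remainder-last i = trans
    (cong (ℤ._-_ (+ part p i)) (sumOver-empty (λ ℓ → n ℕ.≤? toℕ ℓ) (k p i) (λ ℓ → ℕ.<⇒≱ (toℕ<n ℓ))))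
    (ℤ.+-identityʳ _)

  remainder-step : ∀ i j → remainder i (toℕ j) ≡ remainder i (suc (toℕ j)) ℤ.- k p i j
  remainder-step i j = trans
    (cong (ℤ._-_ (+ part p i)) (sumOver-insert (λ ℓ → suc (toℕ j) ℕ.≤? toℕ ℓ) (λ ℓ → toℕ j ℕ.≤? toℕ ℓ)
      (k p i) j ℕ.≤-refl (ℕ.<-irrefl refl) ℕ.<⇒≤
      λ j≤ℓ → [ inj₂ , inj₁ ∘ toℕ-injective ∘ sym ]′ (ℕ.m≤n⇒m<n∨m≡n j≤ℓ)))
    (identity (+ part p i) (k p i j) _)
    where
    identity : ∀ a b c → a ℤ.- (b ℤ.+ c) ≡ a ℤ.- c ℤ.- b
    identity = solve-∀

  -- Supplies the summand `κ′ + c` of `remainder-mono-step`.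
  below-step : ∀ {i i′ j} → toℕ i′ ≡ suc (toℕ i) → i′ ≤ j → below i j ≡ k p i′ j ℤ.+ below i′ j
  below-step {i} {i′} {j} eq i′≤j =
    sumOver-insert (λ ℓ → (i′ <? ℓ) ×-dec (ℓ ≤? j)) (λ ℓ → (i <? ℓ) ×-dec (ℓ ≤? j)) (λ ℓ → k p ℓ j) i′
      (ℕ.≤-reflexive (sym eq) , i′≤j) (ℕ.<-irrefl refl ∘ proj₁)
      (λ (i′<ℓ , ℓ≤j) → ℕ.≤-trans (ℕ.≤-reflexive (sym eq)) (ℕ.<⇒≤ i′<ℓ) , ℓ≤j)
      λ {ℓ} (i<ℓ , ℓ≤j) →
        [ (λ i′<ℓ → inj₂ (i′<ℓ , ℓ≤j)) , inj₁ ∘ toℕ-injective ∘ sym ]′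
          (ℕ.m≤n⇒m<n∨m≡n (subst (ℕ._≤ toℕ ℓ) (sym eq) i<ℓ))

  -- Both claims go through one induction: entries of lower rows make the column sums nonnegative,
  -- and the remainders of the next row bound those of row `i` from below.
  record RowNonNeg (i : Fin n) : Set where
    field
      k≥0         : ∀ j → i ≤ j → 0ℤ ℤ.≤ k p i j
      remainder≥0 : ∀ {t} → toℕ i ℕ.≤ t → t ℕ.≤ n → 0ℤ ℤ.≤ remainder i t

  open RowNonNeg

  -- At `t = n` this is `decreasing`; each column to the left is one `remainder-mono-step`, with
  -- `height` providing the larger divisor.
  remainder-mono : ∀ {i i′} → toℕ i′ ≡ suc (toℕ i) → ∀ {t} → t ℕ.≤ n →
                   toℕ i′ ℕ.≤ t → remainder i′ t ℤ.≤ remainder i t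
  remainder-mono {i} {i′} eq = downward (λ t → toℕ i′ ℕ.≤ t → remainder i′ t ℤ.≤ remainder i t)
    (λ _ → subst₂ ℤ._≤_ (sym (remainder-last i′)) (sym (remainder-last i))
      (ℤ.+≤+ (decreasing p (ℕ.≤-trans (ℕ.n≤1+n _) (ℕ.≤-reflexive (sym eq))))))
    λ j ih i′≤j → subst₂ ℤ._≤_ (sym (remainder-step i′ j)) (sym (remainder-step i j))
      (remainder-mono-step (k-isCapped i′ j)
        (subst₂ (λ c d → IsCappedCeiling m (remainder i (suc (toℕ j)) ℤ.+ c) d (k p i j))
          (below-step eq i′≤j) (height j i′≤j) (k-isCapped i j))
        (ih (ℕ.m≤n⇒m≤1+n i′≤j)))
    where
    height : ∀ (j : Fin n) → i′ ≤ j → toℕ j ℕ.∸ toℕ i ≡ suc (toℕ j ℕ.∸ toℕ i′)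
    height j i′≤j = trans
      (ℕ.+-∸-assoc 1 (ℕ.≤-trans (ℕ.≤-reflexive (sym eq)) i′≤j))
      (cong (λ x → suc (toℕ j ℕ.∸ x)) (sym eq))

  rowNonNeg : ∀ {i} → Acc _>_ i → RowNonNeg i
  rowNonNeg {i} (acc rs) = record
    { k≥0 = κ≥0
    ; remainder≥0 = λ i≤t t≤n → [ (λ i<t → beyond i<t t≤n) , (λ { refl → atDiagonal }) ]′
                                  (ℕ.m≤n⇒m<n∨m≡n i≤t)
    }
    where
    beyond : ∀ {t} → toℕ i ℕ.< t → t ℕ.≤ n → 0ℤ ℤ.≤ remainder i t
    beyond {t} i<t t≤n with ℕ.m≤n⇒m<n∨m≡n t≤n
    ... | inj₂ refl = subst (0ℤ ℤ.≤_) (sym (remainder-last i)) (ℤ.+≤+ z≤n)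
    -- Here `toℕ i < t < n`, so a next row `i′` exists and the induction hypothesis covers it at
    -- `t`.
    ... | inj₁ t<n  = ℤ.≤-trans
      (remainder≥0 (rowNonNeg (rs (ℕ.≤-reflexive (sym eq)))) i′≤t t≤n)
      (remainder-mono eq t≤n i′≤t)
      where
      i′ : Fin n
      i′ = fromℕ< (ℕ.≤-<-trans i<t t<n)
      eq : toℕ i′ ≡ suc (toℕ i)
      eq = toℕ-fromℕ< (ℕ.≤-<-trans i<t t<n)
      i′≤t : toℕ i′ ℕ.≤ t
      i′≤t = subst (ℕ._≤ t) (sym eq) i<t
    below≥0 : ∀ j → 0ℤ ℤ.≤ below i j
    below≥0 j = sumOver-nonNeg (λ ℓ → (i <? ℓ) ×-dec (ℓ ≤? j))
      (λ (i<ℓ , ℓ≤j) → k≥0 (rowNonNeg (rs i<ℓ)) j ℓ≤j)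
    κ≥0 : ∀ j → i ≤ j → 0ℤ ℤ.≤ k p i j
    κ≥0 j i≤j = capped-nonNeg (k-isCapped i j) (+-nonNeg (beyond (s≤s i≤j) (toℕ<n j)) (below≥0 j))
    -- The comparison with row `i′` stops short of `t = toℕ i`. There the divisor is 1 and the
    -- column sum is empty, so `capped-≤` applies.
    atDiagonal : 0ℤ ℤ.≤ remainder i (toℕ i)
    atDiagonal = subst (0ℤ ℤ.≤_) (sym (remainder-step i i)) (ℤ.i≤j⇒0≤j-i (capped-≤
      (subst₂ (λ a d → IsCappedCeiling m a d (k p i i)) noneBelow (ℕ.n∸n≡0 (toℕ i)) (k-isCapped i i))))
      where
      noneBelow : remainder i (suc (toℕ i)) ℤ.+ below i i ≡ remainder i (suc (toℕ i))
      noneBelow = trans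
        (cong (ℤ._+_ (remainder i (suc (toℕ i))))
          (sumOver-empty (λ ℓ → (i <? ℓ) ×-dec (ℓ ≤? i)) (λ ℓ → k p ℓ i) (λ ℓ (i<ℓ , ℓ≤i) → ℕ.<⇒≱ i<ℓ ℓ≤i)))
        (ℤ.+-identityʳ _)

  k-nonNeg : ∀ {i j} → i ≤ j → 0ℤ ℤ.≤ k p i j
  k-nonNeg {i} {j} = k≥0 (rowNonNeg (>-wellFounded i)) j

  ∣k∣≤m : ∀ {i j} → i ≤ j → ∣ k p i j ∣ ℕ.≤ m
  ∣k∣≤m {i} {j} i≤j = ℤ.drop‿+≤+
    (subst (ℤ._≤ + m) (sym (ℤ.0≤i⇒+∣i∣≡i (k-nonNeg i≤j))) (≤cap (k-isCapped i j)))

  -- Starts from `bounded` at `t = n`; the steps need nonnegative column sums. At `t = toℕ i` the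
  -- bound is zero.
  remainder-≤ : ∀ i {t} → t ℕ.≤ n → toℕ i ℕ.≤ t → remainder i t ℤ.≤ + m ℤ.* + (t ℕ.∸ toℕ i)
  remainder-≤ i = downward (λ t → toℕ i ℕ.≤ t → remainder i t ℤ.≤ + m ℤ.* + (t ℕ.∸ toℕ i))
    (λ _ → subst₂ ℤ._≤_ (sym (remainder-last i)) (ℤ.pos-* m (n ℕ.∸ toℕ i)) (ℤ.+≤+ (bounded p i)))
    λ j ih i≤j → subst (ℤ._≤ + m ℤ.* + (toℕ j ℕ.∸ toℕ i)) (sym (remainder-step i j))
      (remainder-≤-step (k-isCapped i j) refl
        (sumOver-nonNeg (λ ℓ → (i <? ℓ) ×-dec (ℓ ≤? j)) (k-nonNeg ∘ proj₂))
        (subst (λ d → remainder i (suc (toℕ j)) ℤ.≤ + m ℤ.* + d) (ℕ.+-∸-assoc 1 i≤j)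
          (ih (ℕ.m≤n⇒m≤1+n i≤j))))

  remainder≡0 : ∀ i → remainder i (toℕ i) ≡ 0ℤ
  remainder≡0 i = ℤ.≤-antisym
    (subst (remainder i (toℕ i) ℤ.≤_)
      (trans (cong (λ d → + m ℤ.* + d) (ℕ.n∸n≡0 (toℕ i))) (ℤ.*-zeroʳ (+ m)))
      (remainder-≤ i (ℕ.<⇒≤ (toℕ<n i)) ℕ.≤-refl))
    (remainder≥0 (rowNonNeg (>-wellFounded i)) ℕ.≤-refl (ℕ.<⇒≤ (toℕ<n i)))

  part≡rowSum : ∀ i → + part p i ≡ sumOver (i ≤?_) (k p i)
  part≡rowSum i = ℤ.i-j≡0⇒i≡j _ _ (remainder≡0 i)

-- Tableau coordinates and the map itself.

columnIndex : ∀ {n} (r : Fin n) → Fin (n ℕ.∸ toℕ r) → Fin n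
columnIndex {n} r c = fromℕ< {n ℕ.∸ suc (toℕ c)}
  (ℕ.∸-monoʳ-< (s≤s z≤n) (ℕ.≤-trans (toℕ<n c) (ℕ.m∸n≤m n (toℕ r))))

toℕ-columnIndex : ∀ {n} (r : Fin n) c → toℕ (columnIndex r c) ≡ n ℕ.∸ suc (toℕ c)
toℕ-columnIndex r c = toℕ-fromℕ< _

≤columnIndex : ∀ {n} (r : Fin n) c → r ≤ columnIndex r c
≤columnIndex {n} r c = subst₂ ℕ._≤_ (ℕ.m∸[m∸n]≡n (ℕ.<⇒≤ (toℕ<n r))) (sym (toℕ-columnIndex r c))
  (ℕ.∸-monoʳ-≤ n (toℕ<n c))

-- Both maps are the reversal `x ↦ n - (1 + x)`, which is its own inverse.
columnIndex-column : ∀ {n} {i j : Fin n} (i≤j : i ≤ j) → columnIndex i (column i≤j) ≡ j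
columnIndex-column {n} {i} {j} i≤j = toℕ-injective (begin
  toℕ (columnIndex i (column i≤j))   ≡⟨ toℕ-columnIndex i (column i≤j) ⟩
  n ℕ.∸ suc (toℕ (column i≤j))       ≡⟨ cong (λ c → n ℕ.∸ suc c) (toℕ-fromℕ< _) ⟩
  n ℕ.∸ suc (n ℕ.∸ suc (toℕ j))      ≡⟨ cong (n ℕ.∸_) (sym (ℕ.+-∸-assoc 1 (toℕ<n j))) ⟩
  n ℕ.∸ (n ℕ.∸ toℕ j)                ≡⟨ ℕ.m∸[m∸n]≡n (ℕ.<⇒≤ (toℕ<n j)) ⟩
  toℕ j                              ∎)
  where open ≡-Reasoning

-- The absolute value only changes the type: `≤columnIndex` keeps to `i ≤ j`, where `k-nonNeg`
-- holds.
tableau : ∀ {m n} → Partition m n → Tableau m n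
tableau p r c = fromℕ< (s≤s (∣k∣≤m p (≤columnIndex r c)))

entry-tableau : ∀ {m n} (p : Partition m n) {i j : Fin n} (i≤j : i ≤ j) →
                + toℕ (entry (tableau p) i≤j) ≡ k p i j
entry-tableau p {i} {j} i≤j = begin
  + toℕ (entry (tableau p) i≤j)               ≡⟨ cong +_ (toℕ-fromℕ< _) ⟩
  + ∣ k p i (columnIndex i (column i≤j)) ∣    ≡⟨ cong (λ ℓ → + ∣ k p i ℓ ∣) (columnIndex-column i≤j) ⟩
  + ∣ k p i j ∣                               ≡⟨ ℤ.0≤i⇒+∣i∣≡i (k-nonNeg p i≤j) ⟩
  k p i j                                     ∎
  where open ≡-Reasoning

-- Each part is the sum of its row, and `entry-tableau` reads that row off the tableau.
tableau-injective : ∀ {m n} → Injective (_≈ᴾ_ {m} {n}) _≈ᵀ_ tableau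
tableau-injective {x = p} {y = q} same i = ℤ.+-injective (begin
  + part p i                  ≡⟨ part≡rowSum p i ⟩
  sumOver (i ≤?_) (k p i)     ≡⟨ sumOver-cong (i ≤?_) (λ i≤j →
                                   trans (sym (entry-tableau p i≤j))
                                     (trans (cong (+_ ∘ toℕ) (same i (column i≤j))) (entry-tableau q i≤j))) ⟩
  sumOver (i ≤?_) (k q i)     ≡⟨ sym (part≡rowSum q i) ⟩
  + part q i                  ∎)
  where open ≡-Reasoning

theorem4p2 : (m n : ℕ) → .{{_ : NonZero m}} → .{{_ : NonZero n}} →
    Σ[ φ ∈ (Partition m n → Tableau m n) ]
    (∀ p {i j : Fin n} (i≤j : i ≤ j) → + toℕ (entry (φ p) i≤j) ≡ k p i j)
    × Injective _≈ᴾ_ _≈ᵀ_ φ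
theorem4p2 m n = tableau , entry-tableau , tableau-injective
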